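{- $\mathsf{FS}^{!\omega} \leq_{\mathrm{sW}} \mathsf{RT}^{!\omega}_2$.
   Context: For $X \subseteq \mathbb{N}$, $[X]^{!\omega}$ is the set of finite $s \subseteq X$ with $|s| = 1+\min s$. $\mathsf{FS}^{!\omega}$ is the problem whose instances are colorings $f : [\mathbb{N}]^{!\omega} \to \mathbb{N}$ and whose solutions for $f$ are infinite sets $H \subseteq \mathbb{N}$ such that for every $s \in [H]^{!\omega}$, $f(s) \notin H \setminus s$. $\mathsf{RT}^{!\omega}_2$ is the problem whose instances are colorings $f : [\mathbb{N}]^{!\omega} \to \{0,1\}$ and whose solutions are infinite $H \subseteq \mathbb{N}$ with $|f([H]^{!\omega})| = 1$. A problem $\mathsf{Q}$ is strongly Weihrauch reducible to $\mathsf{P}$ ($\mathsf{Q} \leq_{\mathrm{sW}} \mathsf{P}$) if there are Turing functionals $\Phi, \Psi$ such that for every instance $X$ of $\mathsf{Q}$, $\Phi(X)$ is an instance of $\mathsf{P}$, and for every solution $Y$ to $\mathsf{P}$ for $\Phi(X)$, $\Psi(Y)$ is a solution to $\mathsf{Q}$ for $X$. -}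

module Defs where

open import Data.Nat using (ℕ; suc; _≤_; _<_)
open import Data.Bool using (Bool; true)
open import Data.List using (List; []; _∷_; length)
open import Data.List.Relation.Unary.All using (All)
open import Data.List.Relation.Unary.Linked using (Linked)
open import Data.List.Membership.Propositional using (_∈_)
open import Data.Product using (_×_; ∃-syntax; Σ)
open import Data.Empty using (⊥)
open import Relation.Nullary using (¬_)
open import Relation.Binary.PropositionalEquality using (_≡_)

Subset : Set
Subset = ℕ → Bool

-- Finite subsets of ℕ are represented by strictly increasing lists.
-- A list is in [ℕ]^{!ω} iff it is strictly increasing, nonempty, and
-- its length is 1 + its least element (= its head).
BangSize : List ℕ → Set
BangSize []      = ⊥
BangSize (a ∷ s) = length (a ∷ s) ≡ suc a

IsBang : List ℕ → Set
IsBang s = Linked _<_ s × BangSize s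

BangOf : Subset → List ℕ → Set
BangOf H s = IsBang s × All (λ x → H x ≡ true) s

Infinite : Subset → Set
Infinite H = ∀ n → ∃[ m ] (n ≤ m × H m ≡ true)

-- Instances: colorings of [ℕ]^{!ω}, given as functions on (codes of)
-- finite sets; only values on lists satisfying IsBang matter.
FSInstance : Set
FSInstance = List ℕ → ℕ

RT2Instance : Set
RT2Instance = List ℕ → Bool

FSSolution : FSInstance → Subset → Set
FSSolution f H =
  Infinite H × (∀ s → BangOf H s → ¬ (H (f s) ≡ true × ¬ (f s ∈ s)))

RT2Solution : RT2Instance → Subset → Set
RT2Solution g H =
  Infinite H × ∃[ c ] (∀ s → BangOf H s → g s ≡ c)

-- Strong Weihrauch reduction FS^{!ω} ≤sW RT^{!ω}_2, with Turing functionals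
-- modelled as (necessarily computable) Agda functions.
FS≤sWRT2 : Set
FS≤sWRT2 =
  Σ (FSInstance → RT2Instance) λ Φ → Σ (Subset → Subset) λ Ψ → (∀ (f : FSInstance) (Y : Subset) →
     RT2Solution (Φ f) Y → FSSolution f (Ψ Y))

-- Let Ψ shift a set down by one and let Φ colour t = (s + 1) ∪ {z} by p(s) xor [z = f(s) + 1],
-- where p(s) is the parity of the length of the run s, s′, s″, … in which s′ consists of the
-- first 1 + min elements of s ∪ {f(s)}, continued as long as the sum of the elements
-- strictly decreases. Let Y be homogeneous of colour c and H = Y − 1. Choosing z large shows
-- p(s) = c for every s ∈ [H]^{!ω}. Now suppose f(s) ∈ H ∖ s. If f(s) > max s, then z = f(s) + 1
-- gives colour ¬ p(s). If f(s) < max s, then s′ ∈ [H]^{!ω} has smaller sum (max s is cut off),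
-- so p(s) = ¬ p(s′). Both cases contradict homogeneity.
module Submission where

open import Defs
open import Algebra.Properties.CommutativeSemigroup using (x∙yz≈y∙xz)
open import Data.Bool using (Bool; true; false; not; _xor_; if_then_else_)
open import Data.Bool.Properties using (not-¬)
open import Data.Empty using (⊥)
open import Data.List using (List; []; _∷_; _∷ʳ_; length; map; take; head)
open import Data.List.Membership.Propositional using (_∈_; _∉_)
open import Data.List.Properties using (map-∘; map-id; length-++; length-map; length-take)
open import Data.List.Relation.Unary.All using (All; []; _∷_)
import Data.List.Relation.Unary.All.Properties as All
open import Data.List.Relation.Unary.Any using (here; there)
open import Data.List.Relation.Unary.Linked as Linked using (Linked; []; [-]; _∷_)
import Data.List.Relation.Unary.Linked.Properties as Linked
open import Data.Maybe using (just)
open import Data.Nat using (ℕ; zero; suc; pred; _+_; _⊓_; _≤_; _<_; _≰_; _≤?_; _<?_; _≟_; s≤s)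
open import Data.Nat.ListAction using (sum)
open import Data.Nat.Properties
  using ( ≤-decTotalOrder; +-commutativeSemigroup; module ≤-Reasoning
        ; ≤-trans; <-≤-trans; ≤-pred; <⇒≤; <⇒≢; ≰⇒>; ≰⇒≥; ≤∧≢⇒<; <-cmp; n<1+n
        ; pred-mono-≤; suc-injective; m≤m+n; m≤n+m; +-comm; +-assoc; +-monoʳ-≤; +-monoˡ-<
        ; +-cancelʳ-<; m⊓n≤n; m≤n⇒m⊓n≡m; m≥n⇒m⊓n≡n )
open import Data.List.Sort.InsertionSort.Base ≤-decTotalOrder using (insert)
open import Data.Product using (_×_; _,_; proj₁; ∃-syntax)
open import Function using (_∘_)
open import Level using (Level)
open import Relation.Binary using (Rel; tri<; tri≈; tri>)
open import Relation.Binary.PropositionalEquality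
  using (_≡_; _≢_; refl; sym; trans; cong; cong₂; subst; module ≡-Reasoning)
open import Relation.Nullary using (¬_; yes; no; does; contradiction)
open import Relation.Nullary.Decidable using (dec-true; dec-false)
open import Relation.Unary using (Pred)

private
  variable
    a b ℓ : Level
    A : Set a
    B : Set b

lastOr : A → List A → A
lastOr d []       = d
lastOr d (x ∷ xs) = lastOr x xs

init : List A → List A
init []           = []
init (x ∷ [])     = []
init (x ∷ y ∷ ys) = x ∷ init (y ∷ ys)

lastOr-∷ʳ : ∀ (d : A) xs z → lastOr d (xs ∷ʳ z) ≡ z
lastOr-∷ʳ d []       z = refl
lastOr-∷ʳ d (x ∷ xs) z = lastOr-∷ʳ x xs z

init-∷ʳ : ∀ (xs : List A) z → init (xs ∷ʳ z) ≡ xs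
init-∷ʳ []           z = refl
init-∷ʳ (x ∷ [])     z = refl
init-∷ʳ (x ∷ y ∷ ys) z = cong (x ∷_) (init-∷ʳ (y ∷ ys) z)

lastOr-∈ : ∀ (x : A) xs → lastOr x xs ∈ x ∷ xs
lastOr-∈ x []       = here refl
lastOr-∈ x (y ∷ ys) = there (lastOr-∈ y ys)

lastOr-map : ∀ (f : A → B) x xs → lastOr (f x) (map f xs) ≡ f (lastOr x xs)
lastOr-map f x []       = refl
lastOr-map f x (y ∷ ys) = lastOr-map f y ys

Linked-∷ʳ : ∀ {R : Rel A ℓ} {x xs z} → Linked R (x ∷ xs) → R (lastOr x xs) z →
            Linked R ((x ∷ xs) ∷ʳ z)
Linked-∷ʳ [-]       r = r ∷ [-]
Linked-∷ʳ (r′ ∷ rs) r = r′ ∷ Linked-∷ʳ rs r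

Linked-take : ∀ {R : Rel A ℓ} n {xs} → Linked R xs → Linked R (take n xs)
Linked-take zero          _        = []
Linked-take (suc n)       []       = []
Linked-take (suc zero)    [-]      = [-]
Linked-take (suc (suc n)) [-]      = [-]
Linked-take (suc zero)    (r ∷ rs) = [-]
Linked-take (suc (suc n)) (r ∷ rs) = r ∷ Linked-take (suc n) rs

lastOr≤sum : ∀ x xs → lastOr x xs ≤ sum (x ∷ xs)
lastOr≤sum x []       = m≤m+n x 0
lastOr≤sum x (y ∷ ys) = ≤-trans (lastOr≤sum y ys) (m≤n+m _ x)

sum-take+lastOr≤sum : ∀ d n xs → n < length xs → sum (take n xs) + lastOr d xs ≤ sum xs
sum-take+lastOr≤sum d zero    (x ∷ xs) _             = lastOr≤sum x xs
sum-take+lastOr≤sum d (suc n) (x ∷ xs) (s≤s n<∣xs∣) = begin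
  (x + sum (take n xs)) + lastOr x xs ≡⟨ +-assoc x _ _ ⟩
  x + (sum (take n xs) + lastOr x xs) ≤⟨ +-monoʳ-≤ x (sum-take+lastOr≤sum x n xs n<∣xs∣) ⟩
  x + sum xs                          ∎
  where open ≤-Reasoning

insert-≤ : ∀ {v x} xs → v ≤ x → insert v (x ∷ xs) ≡ v ∷ x ∷ xs
insert-≤ {v} {x} xs v≤x =
  cong (λ b → if b then v ∷ x ∷ xs else x ∷ insert v xs) (dec-true (v ≤? x) v≤x)

insert-≰ : ∀ {v x} xs → v ≰ x → insert v (x ∷ xs) ≡ x ∷ insert v xs
insert-≰ {v} {x} xs v≰x =
  cong (λ b → if b then v ∷ x ∷ xs else x ∷ insert v xs) (dec-false (v ≤? x) v≰x)

length-insert : ∀ v xs → length (insert v xs) ≡ suc (length xs)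
length-insert v []       = refl
length-insert v (x ∷ xs) with v ≤? x
... | yes v≤x rewrite insert-≤ xs v≤x = refl
... | no  v≰x rewrite insert-≰ xs v≰x = cong suc (length-insert v xs)

sum-insert : ∀ v xs → sum (insert v xs) ≡ v + sum xs
sum-insert v []       = refl
sum-insert v (x ∷ xs) with v ≤? x
... | yes v≤x rewrite insert-≤ xs v≤x = refl
... | no  v≰x rewrite insert-≰ xs v≰x =
  trans (cong (x +_) (sum-insert v xs)) (x∙yz≈y∙xz +-commutativeSemigroup x v (sum xs))

head-insert : ∀ v x xs → head (insert v (x ∷ xs)) ≡ just (v ⊓ x)
head-insert v x xs with v ≤? x
... | yes v≤x rewrite insert-≤ xs v≤x = cong just (sym (m≤n⇒m⊓n≡m v≤x))
... | no  v≰x rewrite insert-≰ xs v≰x = cong just (sym (m≥n⇒m⊓n≡n (≰⇒≥ v≰x)))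

lastOr-insert : ∀ {v} d x xs → v < lastOr x xs → lastOr d (insert v (x ∷ xs)) ≡ lastOr x xs
lastOr-insert {v} d x xs v<L with v ≤? x
... | yes v≤x rewrite insert-≤ xs v≤x = refl
lastOr-insert d x []       v<x | no v≰x = contradiction (<⇒≤ v<x) v≰x
lastOr-insert d x (y ∷ ys) v<L | no v≰x rewrite insert-≰ (y ∷ ys) v≰x = lastOr-insert x y ys v<L

All-insert : ∀ {P : Pred ℕ ℓ} {v xs} → P v → All P xs → All P (insert v xs)
All-insert         pv []                                  = pv ∷ []
All-insert {v = v} pv (_∷_ {x = x} {xs = xs} px pxs) with v ≤? x
... | yes v≤x rewrite insert-≤ xs v≤x = pv ∷ px ∷ pxs
... | no  v≰x rewrite insert-≰ xs v≰x = px ∷ All-insert pv pxs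

Linked-insert : ∀ {v xs} → v ∉ xs → Linked _<_ xs → Linked _<_ (insert v xs)
Linked-insert {v} {[]}     _  _ = [-]
Linked-insert {v} {x ∷ xs} v∉ l with v ≤? x
... | yes v≤x rewrite insert-≤ xs v≤x = ≤∧≢⇒< v≤x (v∉ ∘ here) ∷ l
Linked-insert {v} {x ∷ []}     v∉ l         | no v≰x rewrite insert-≰ [] v≰x = ≰⇒> v≰x ∷ [-]
Linked-insert {v} {x ∷ y ∷ ys} v∉ (x<y ∷ l) | no v≰x rewrite insert-≰ (y ∷ ys) v≰x
  with v ≤? y | Linked-insert (v∉ ∘ there) l
... | yes v≤y | l′ rewrite insert-≤ ys v≤y = ≰⇒> v≰x ∷ l′
... | no  v≰y | l′ rewrite insert-≰ ys v≰y = x<y ∷ l′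

bangPrefix : List ℕ → List ℕ
bangPrefix []       = []
bangPrefix (m ∷ ms) = take (suc m) (m ∷ ms)

bangPrefix-IsBang : ∀ {m ms} → Linked _<_ (m ∷ ms) → m ≤ length ms → IsBang (bangPrefix (m ∷ ms))
bangPrefix-IsBang {m} {ms} l m≤∣ms∣ =
  Linked-take (suc m) l , cong suc (trans (length-take m ms) (m≤n⇒m⊓n≡m m≤∣ms∣))

All-bangPrefix : ∀ {P : Pred ℕ ℓ} {ms} → All P ms → All P (bangPrefix ms)
All-bangPrefix []         = []
All-bangPrefix (pm ∷ pms) = pm ∷ All.take⁺ _ pms

insert-head<∣tail∣ : ∀ v {a s₀} → BangSize (a ∷ s₀) →
                     ∃[ m ] ∃[ ms ] (insert v (a ∷ s₀) ≡ m ∷ ms × m < length ms)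
insert-head<∣tail∣ v {a} {s₀} ∣s∣≡1+a
  with insert v (a ∷ s₀) | length-insert v (a ∷ s₀) | head-insert v a s₀
... | m ∷ ms | ∣M∣≡1+∣s∣ | refl = m , ms , refl , (begin-strict
  v ⊓ a           <⟨ s≤s (m⊓n≤n v a) ⟩
  suc a           ≡⟨ ∣s∣≡1+a ⟨
  length (a ∷ s₀) ≡⟨ suc-injective ∣M∣≡1+∣s∣ ⟨
  length ms       ∎)
  where open ≤-Reasoning

step : ℕ → List ℕ → List ℕ
step v s = bangPrefix (insert v s)

step-BangOf : ∀ {H v s} → BangOf H s → H v ≡ true → v ∉ s → BangOf H (step v s)
step-BangOf {H} {v} {a ∷ s₀} ((l , ∣s∣≡1+a) , Hs) Hv v∉s
  with insert-head<∣tail∣ v ∣s∣≡1+a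
... | m , ms , M≡m∷ms , m<∣ms∣ =
  subst (IsBang ∘ bangPrefix) (sym M≡m∷ms)
        (bangPrefix-IsBang (subst (Linked _<_) M≡m∷ms (Linked-insert v∉s l)) (<⇒≤ m<∣ms∣))
  , All-bangPrefix (All-insert Hv Hs)

sum-step< : ∀ {v s} → IsBang s → v < lastOr 0 s → sum (step v s) < sum s
sum-step< {v} {a ∷ s₀} (_ , ∣s∣≡1+a) v<L with insert-head<∣tail∣ v ∣s∣≡1+a
... | m , ms , M≡m∷ms , m<∣ms∣ = +-cancelʳ-< (lastOr a s₀) _ _ (begin-strict
  sum (step v (a ∷ s₀)) + lastOr a s₀     ≡⟨ cong (λ M → sum (bangPrefix M) + lastOr a s₀) M≡m∷ms ⟩
  sum (bangPrefix (m ∷ ms)) + lastOr a s₀ ≡⟨ cong (sum (bangPrefix (m ∷ ms)) +_) L′≡L ⟨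
  sum (bangPrefix (m ∷ ms)) + lastOr m ms ≤⟨ sum-take+lastOr≤sum m (suc m) (m ∷ ms) (s≤s m<∣ms∣) ⟩
  sum (m ∷ ms)                            ≡⟨ cong sum M≡m∷ms ⟨
  sum (insert v (a ∷ s₀))                 ≡⟨ sum-insert v (a ∷ s₀) ⟩
  v + sum (a ∷ s₀)                        <⟨ +-monoˡ-< _ v<L ⟩
  lastOr a s₀ + sum (a ∷ s₀)              ≡⟨ +-comm (lastOr a s₀) _ ⟩
  sum (a ∷ s₀) + lastOr a s₀              ∎)
  where
  open ≤-Reasoning
  L′≡L : lastOr m ms ≡ lastOr a s₀
  L′≡L = trans (cong (lastOr 0) (sym M≡m∷ms)) (lastOr-insert 0 a s₀ v<L)

module DescentParity {A : Set a} (next : A → A) (μ : A → ℕ) where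

  parityWithin : ℕ → A → Bool
  parityWithin zero    x = false
  parityWithin (suc n) x with μ (next x) <? μ x
  ... | yes _ = not (parityWithin n (next x))
  ... | no  _ = false

  parityWithin-fuel-irrelevant : ∀ {m n} x → μ x < m → μ x < n → parityWithin m x ≡ parityWithin n x
  parityWithin-fuel-irrelevant {suc m} {suc n} x μx<1+m μx<1+n with μ (next x) <? μ x
  ... | yes μx′<μx = cong not (parityWithin-fuel-irrelevant (next x)
                       (<-≤-trans μx′<μx (≤-pred μx<1+m)) (<-≤-trans μx′<μx (≤-pred μx<1+n)))
  ... | no  _      = refl

  -- μ strictly decreases along the run, so it takes at most μ x steps.
  parity : A → Bool
  parity x = parityWithin (suc (μ x)) x

  parity-next : ∀ x → μ (next x) < μ x → parity x ≡ not (parity (next x))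
  parity-next x μx′<μx with μ (next x) <? μ x
  ... | yes _      = cong not (parityWithin-fuel-irrelevant (next x) μx′<μx (n<1+n _))
  ... | no  μx′≮μx = contradiction μx′<μx μx′≮μx

shift : Subset → Subset
shift Y n = Y (suc n)

Infinite-shift : ∀ {Y} → Infinite Y → Infinite (shift Y)
Infinite-shift infY n with infY (suc n)
... | suc m , s≤s n≤m , Ym = m , n≤m , Ym

BangOf-suc-∷ʳ : ∀ {Y s z} → BangOf (shift Y) s → suc (lastOr 0 s) < z → Y z ≡ true →
                BangOf Y (map suc s ∷ʳ z)
BangOf-suc-∷ʳ {Y} {a ∷ s₀} {z} ((l , ∣s∣≡1+a) , Ys) 1+L<z Yz =
  ( Linked-∷ʳ (Linked.map⁺ (Linked.map s≤s l)) (subst (_< z) (sym (lastOr-map suc a s₀)) 1+L<z)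
  , cong suc ∣suc-s₀∷ʳz∣≡1+a )
  , All.∷ʳ⁺ (All.map⁺ Ys) Yz
  where
  open ≡-Reasoning
  ∣suc-s₀∷ʳz∣≡1+a : length (map suc s₀ ∷ʳ z) ≡ suc a
  ∣suc-s₀∷ʳz∣≡1+a = begin
    length (map suc s₀ ∷ʳ z)  ≡⟨ length-++ (map suc s₀) ⟩
    length (map suc s₀) + 1   ≡⟨ +-comm _ 1 ⟩
    suc (length (map suc s₀)) ≡⟨ cong suc (length-map suc s₀) ⟩
    suc (length s₀)           ≡⟨ ∣s∣≡1+a ⟩
    suc a                     ∎

module Reduction (f : FSInstance) where

  next : List ℕ → List ℕ
  next s = step (f s) s

  open DescentParity next sum

  extensionColour : List ℕ → ℕ → Bool
  extensionColour s z = does (f s ≟ pred z) xor parity s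

  -- t ∈ [ℕ]^{!ω} is read as (s + 1) ∪ {z} with z = max t; then s ∈ [ℕ]^{!ω} as well.
  colouring : RT2Instance
  colouring t = extensionColour (map pred (init t)) (lastOr 0 t)

  colouring-∷ʳ : ∀ s z → colouring (map suc s ∷ʳ z) ≡ extensionColour s z
  colouring-∷ʳ s z = cong₂ extensionColour decoded (lastOr-∷ʳ 0 (map suc s) z)
    where
    open ≡-Reasoning
    decoded : map pred (init (map suc s ∷ʳ z)) ≡ s
    decoded = begin
      map pred (init (map suc s ∷ʳ z)) ≡⟨ cong (map pred) (init-∷ʳ (map suc s) z) ⟩
      map pred (map suc s)             ≡⟨ map-∘ s ⟨
      map (pred ∘ suc) s               ≡⟨ map-id s ⟩
      s                                ∎

  module _ {Y : Subset} (infY : Infinite Y) {c : Bool}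
           (homogeneous : ∀ t → BangOf Y t → colouring t ≡ c) where

    extensionColour≡c : ∀ {s z} → BangOf (shift Y) s → suc (lastOr 0 s) < z → Y z ≡ true →
                        extensionColour s z ≡ c
    extensionColour≡c {s} {z} Hs 1+L<z Yz =
      trans (sym (colouring-∷ʳ s z)) (homogeneous _ (BangOf-suc-∷ʳ Hs 1+L<z Yz))

    parity≡c : ∀ {s} → BangOf (shift Y) s → parity s ≡ c
    parity≡c {s} Hs with infY (suc (suc (lastOr 0 s + f s)))
    ... | z , 2+L+fs≤z , Yz = begin
      parity s                         ≡⟨ cong (_xor parity s) (dec-false (f s ≟ pred z) fs≢z-1) ⟨
      does (f s ≟ pred z) xor parity s ≡⟨ extensionColour≡c Hs 1+L<z Yz ⟩
      c                                ∎
      where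
      open ≡-Reasoning
      1+L<z : suc (lastOr 0 s) < z
      1+L<z = ≤-trans (s≤s (s≤s (m≤m+n _ (f s)))) 2+L+fs≤z
      fs≢z-1 : f s ≢ pred z
      fs≢z-1 = <⇒≢ (≤-trans (s≤s (m≤n+m (f s) _)) (pred-mono-≤ 2+L+fs≤z))

    no-escape-above : ∀ {s} → BangOf (shift Y) s → shift Y (f s) ≡ true → lastOr 0 s < f s → ⊥
    no-escape-above {s} Hs Hfs L<fs = not-¬ refl (begin
      parity s                      ≡⟨ parity≡c Hs ⟩
      c                             ≡⟨ extensionColour≡c Hs (s≤s L<fs) Hfs ⟨
      does (f s ≟ f s) xor parity s ≡⟨ cong (_xor parity s) (dec-true (f s ≟ f s) refl) ⟩
      not (parity s)                ∎)
      where open ≡-Reasoning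

    no-escape-below : ∀ {s} → BangOf (shift Y) s → shift Y (f s) ≡ true → f s ∉ s →
                      f s < lastOr 0 s → ⊥
    no-escape-below {s} Hs Hfs fs∉s fs<L = not-¬ refl (begin
      c                     ≡⟨ parity≡c Hs ⟨
      parity s              ≡⟨ parity-next s (sum-step< (proj₁ Hs) fs<L) ⟩
      not (parity (next s)) ≡⟨ cong not (parity≡c (step-BangOf Hs Hfs fs∉s)) ⟩
      not c                 ∎)
      where open ≡-Reasoning

    solution : FSSolution f (shift Y)
    solution = Infinite-shift infY , no-escape
      where
      no-escape : ∀ s → BangOf (shift Y) s → ¬ (shift Y (f s) ≡ true × f s ∉ s)
      no-escape s@(a ∷ s₀) Hs (Hfs , fs∉s) with <-cmp (f s) (lastOr a s₀)
      ... | tri< fs<L _ _ = no-escape-below Hs Hfs fs∉s fs<L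
      ... | tri≈ _ fs≡L _ = fs∉s (subst (_∈ s) (sym fs≡L) (lastOr-∈ a s₀))
      ... | tri> _ _ L<fs = no-escape-above Hs Hfs L<fs

theorem3p4 : FS≤sWRT2
theorem3p4 =
  Reduction.colouring , shift , λ f Y (infY , c , homogeneous) → Reduction.solution f infY homogeneous
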